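{- For every integer $n\ge 1$, the number $S_n(2431,4231,1432,4132)$ of permutations of length $n$ that avoid all four of the patterns $2431$, $4231$, $1432$ and $4132$ satisfies \[ S_n(2431,4231,1432,4132)=\binom{2(n-1)}{n-1}=b_{n-1}, \] where $b_m=\binom{2m}{m}$ denotes the $m$-th central binomial coefficient.
   Context: A permutation of length $n$ is a bijection of $[n]=\{1,\dots,n\}$, written in one-line notation $\tau=\tau(1)\tau(2)\cdots\tau(n)$. A permutation $\tau$ of length $n$ contains a permutation $\pi$ of length $k\le n$ as a pattern if there are indices $i_1<i_2<\dots<i_k$ such that the subsequence $\tau(i_1)\tau(i_2)\cdots\tau(i_k)$ is order-isomorphic to $\pi$, i.e. $\tau(i_a)<\tau(i_b)$ if and only if $\pi(a)<\pi(b)$ for all $a,b\in[k]$. Otherwise (in particular if $k>n$) $\tau$ avoids $\pi$. For a finite set $\Pi$ of permutations, $S_n(\Pi)$ denotes the number of permutations of length $n$ that avoid every pattern in $\Pi$. -}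

module Defs where

open import Data.Fin.Base using (Fin; _<_)
open import Data.Fin.Patterns using (0F; 1F; 2F; 3F)
open import Data.Fin.Permutation
  using (Permutation′; permutation; _⟨$⟩ʳ_; _≈_; ↔⇒≡)
open import Data.Fin.Properties using (_≟_; all?)
open import Data.List.Base using (List)
open import Data.List.Relation.Unary.All using (All)
open import Data.Nat.Base using (ℕ)
open import Data.Product.Base using (Σ; Σ-syntax; ∃; _×_; _,_; proj₁)
open import Data.Vec.Base using (Vec; _∷_; []; lookup)
open import Function.Bundles using (Inverse; _⇔_)
import Function.Construct.Composition as Composition
import Function.Construct.Symmetry as Symmetry
open import Level using (0ℓ)
open import Relation.Binary.Bundles using (Setoid)
import Relation.Binary.Construct.On as On
open import Relation.Binary.PropositionalEquality as ≡ using (_≡_)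
open import Relation.Nullary.Decidable using (True; toWitness)
open import Relation.Nullary.Negation using (¬_)

_Contains_ : ∀ {n k} → Permutation′ n → Permutation′ k → Set
_Contains_ {n} {k} τ π =
  Σ[ i ∈ (Fin k → Fin n) ]
    (∀ {a b : Fin k} → a < b → i a < i b)
    × (∀ (a b : Fin k) → (τ ⟨$⟩ʳ i a) < (τ ⟨$⟩ʳ i b) ⇔ (π ⟨$⟩ʳ a) < (π ⟨$⟩ʳ b))

_Avoids_ : ∀ {n k} → Permutation′ n → Permutation′ k → Set
τ Avoids π = ¬ (τ Contains π)

Patterns : Set
Patterns = List (∃ Permutation′)

_AvoidsAll_ : ∀ {n} → Permutation′ n → Patterns → Set
τ AvoidsAll Π = All (λ (_ , π) → τ Avoids π) Π

permutationSetoid : ℕ → Setoid 0ℓ 0ℓ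
permutationSetoid n = record
  { Carrier       = Permutation′ n
  ; _≈_           = _≈_
  ; isEquivalence = record
    { refl  = λ _ → ≡.refl
    ; sym   = λ p i → ≡.sym (p i)
    ; trans = λ p q i → ≡.trans (p i) (q i)
    }
  }

-- Two avoiders are equal when they agree as functions; the avoidance proofs
-- are not compared.
Avoiders : ℕ → Patterns → Setoid 0ℓ 0ℓ
Avoiders n Π = On.setoid {B = Σ (Permutation′ n) (_AvoidsAll Π)} (permutationSetoid n) proj₁

-- S[ n , Π ]≡ N reads S_n(Π) = N: the avoiders are in bijection with Fin N.
S[_,_]≡_ : ℕ → Patterns → ℕ → Set
S[ n , Π ]≡ N = Inverse (≡.setoid (Fin N)) (Avoiders n Π)

S-unique : ∀ {n Π M N} → S[ n , Π ]≡ M → S[ n , Π ]≡ N → M ≡ N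
S-unique p q = ↔⇒≡ (Composition.inverse p (Symmetry.inverse q))

-- The first vector is the one-line notation, with entries (like positions)
-- counted from 0; the second is the one-line notation of the inverse.
oneLine : ∀ {n} (v w : Vec (Fin n) n) →
          {True (all? λ i → lookup v (lookup w i) ≟ i)} →
          {True (all? λ i → lookup w (lookup v i) ≟ i)} →
          Permutation′ n
oneLine v w {vw} {wv} = permutation (lookup v) (lookup w) (toWitness vw) (toWitness wv)

π2431 π4231 π1432 π4132 : Permutation′ 4
π2431 = oneLine (1F ∷ 3F ∷ 2F ∷ 0F ∷ []) (3F ∷ 0F ∷ 2F ∷ 1F ∷ [])
π4231 = oneLine (3F ∷ 1F ∷ 2F ∷ 0F ∷ []) (3F ∷ 1F ∷ 2F ∷ 0F ∷ [])
π1432 = oneLine (0F ∷ 3F ∷ 2F ∷ 1F ∷ []) (0F ∷ 3F ∷ 2F ∷ 1F ∷ [])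
π4132 = oneLine (3F ∷ 0F ∷ 2F ∷ 1F ∷ []) (1F ∷ 3F ∷ 2F ∷ 0F ∷ [])

{-# OPTIONS --safe #-}

-- A permutation avoids the four patterns iff every entry is a left-to-right
-- minimum, a left-to-right maximum or a right-to-left minimum. Read such a
-- permutation from the left: when t values remain, of which ℓ lie below and h
-- above everything read so far, the next value is one of the ℓ low ones, one
-- of the h high ones, or the least remaining one. The number of completions is
-- therefore 2^(ℓ-1) (1 if ℓ = 0) times the ballot number
-- C(t+h, h) - C(t+h, h-1), and summing over the first entry gives the central
-- binomial coefficient.

module Submission where

open import Defs
open import Data.Fin.Base as Fin using (Fin; punchIn; toℕ; fromℕ<; splitAt; join)
open import Data.Fin.Patterns using (0F; 1F; 2F; 3F)
open import Data.Fin.Permutation as Perm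
  using (Permutation′; _⟨$⟩ʳ_; _⟨$⟩ˡ_; _≈_; inverseʳ; inverseˡ; insert; remove)
import Data.Fin.Properties as Fin
open import Data.List.Base using (_∷_; [])
open import Data.List.Relation.Unary.All using (_∷_; [])
open import Data.Nat.Base
open import Data.Nat.Combinatorics using (_C_; nCk≡nC[n∸k]; nCn≡1; nCk+nC[k+1]≡[n+1]C[k+1])
open import Data.Nat.Properties
open import Data.Nat.Tactic.RingSolver using (solve-∀)
open import Data.Product.Base using (∃-syntax; _×_; _,_)
open import Data.Sum.Base using (_⊎_; inj₁; inj₂; [_,_]′)
open import Data.Vec.Base using (_∷_; []; lookup)
open import Function.Base using (_∘_)
open import Function.Bundles using (_⇔_; mk⇔; Equivalence)
open import Function.Properties.Bijection using (Bijection⇒Inverse)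
open import Relation.Binary.Definitions using (Tri; tri<; tri≈; tri>)
open import Relation.Binary.PropositionalEquality hiding ([_])
open import Relation.Nullary using (¬_; yes; no; contradiction)
open import Relation.Nullary.Decidable using (_→-dec_)
open import Relation.Unary using (Decidable)

private variable
  n t M N : ℕ

-- Extremal entries of a permutation

_[_] : Permutation′ n → Fin n → ℕ
τ [ i ] = toℕ (τ ⟨$⟩ʳ i)

[]-injective : ∀ (τ : Permutation′ n) {i j} → τ [ i ] ≡ τ [ j ] → i ≡ j
[]-injective τ eq =
  trans (sym (inverseˡ τ)) (trans (cong (τ ⟨$⟩ˡ_) (Fin.toℕ-injective eq)) (inverseˡ τ))

LRMin LRMax RLMin : Permutation′ n → Fin n → Set
LRMin τ j = ∀ i → i Fin.< j → τ [ j ] < τ [ i ]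
LRMax τ j = ∀ i → i Fin.< j → τ [ i ] < τ [ j ]
RLMin τ j = ∀ k → j Fin.< k → τ [ j ] < τ [ k ]

-- Here τ records the relative order of the entries that remain after some prefix:
-- ℓ of them lie below the whole prefix and h of them lie above it.
Extremal : (ℓ h : ℕ) → Permutation′ n → Fin n → Set
Extremal {n} ℓ h τ j = (τ [ j ] < ℓ × LRMin τ j) ⊎ (n ≤ τ [ j ] + h × LRMax τ j) ⊎ RLMin τ j

AllExtremal : (ℓ h : ℕ) → Permutation′ n → Set
AllExtremal ℓ h τ = ∀ j → Extremal ℓ h τ j

AllExtremal-resp-≈ : ∀ {ℓ h} (σ τ : Permutation′ n) → σ ≈ τ → AllExtremal ℓ h σ → AllExtremal ℓ h τ
AllExtremal-resp-≈ {n} {ℓ} {h} σ τ eq ext j with ext j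
... | inj₁ (b , m) = inj₁ (subst (_< ℓ) (eq′ j) b , λ i p → subst₂ _<_ (eq′ j) (eq′ i) (m i p))
  where eq′ = λ i → cong toℕ (eq i)
... | inj₂ (inj₁ (b , m)) =
  inj₂ (inj₁ (subst (λ x → n ≤ x + h) (eq′ j) b , λ i p → subst₂ _<_ (eq′ i) (eq′ j) (m i p)))
  where eq′ = λ i → cong toℕ (eq i)
... | inj₂ (inj₂ m) = inj₂ (inj₂ λ k p → subst₂ _<_ (eq′ j) (eq′ k) (m k p))
  where eq′ = λ i → cong toℕ (eq i)

-- Removing the first entry

punchIn-split : ∀ (i : Fin (suc n)) j →
  (toℕ j < toℕ i × toℕ (punchIn i j) ≡ toℕ j) ⊎ (toℕ i ≤ toℕ j × toℕ (punchIn i j) ≡ suc (toℕ j))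
punchIn-split Fin.zero    j           = inj₂ (z≤n , refl)
punchIn-split (Fin.suc i) Fin.zero    = inj₁ (z<s , refl)
punchIn-split (Fin.suc i) (Fin.suc j) with punchIn-split i j
... | inj₁ (p , q) = inj₁ (s<s p , cong suc q)
... | inj₂ (p , q) = inj₂ (s≤s p , cong suc q)

module _ (τ : Permutation′ (suc t)) where

  private
    v = τ [ 0F ]
    σ = remove 0F τ

    v≤t : v ≤ t
    v≤t = Fin.toℕ≤pred[n] (τ ⟨$⟩ʳ 0F)

  suc-value : ∀ j → τ [ Fin.suc j ] ≡ toℕ (punchIn (τ ⟨$⟩ʳ 0F) (σ ⟨$⟩ʳ j))
  suc-value j = cong toℕ (Perm.punchIn-permute τ 0F j)

  suc-split : ∀ j →
    (σ [ j ] < v × τ [ Fin.suc j ] ≡ σ [ j ]) ⊎ (v ≤ σ [ j ] × τ [ Fin.suc j ] ≡ suc (σ [ j ]))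
  suc-split j with punchIn-split (τ ⟨$⟩ʳ 0F) (σ ⟨$⟩ʳ j)
  ... | inj₁ (p , q) = inj₁ (p , trans (suc-value j) q)
  ... | inj₂ (p , q) = inj₂ (p , trans (suc-value j) q)

  remove-mono : ∀ {i j} → σ [ i ] < σ [ j ] → τ [ Fin.suc i ] < τ [ Fin.suc j ]
  remove-mono {i} {j} p = ≰⇒> λ q → <⇒≱ p
    (Fin.punchIn-cancel-≤ (τ ⟨$⟩ʳ 0F) (σ ⟨$⟩ʳ j) (σ ⟨$⟩ʳ i) (subst₂ _≤_ (suc-value j) (suc-value i) q))

  remove-cancel : ∀ {i j} → τ [ Fin.suc i ] < τ [ Fin.suc j ] → σ [ i ] < σ [ j ]
  remove-cancel {i} {j} p = ≰⇒> λ q → <⇒≱ p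
    (subst₂ _≤_ (sym (suc-value j)) (sym (suc-value i))
      (Fin.punchIn-mono-≤ (τ ⟨$⟩ʳ 0F) (σ ⟨$⟩ʳ j) (σ ⟨$⟩ʳ i) q))

  -- Once `v` has been read, a remaining value lies below the whole prefix iff it is below both the
  -- old bound `ℓ` and `v`, and above it iff it is among the top `h` and above `v`; hence the two
  -- minima. The comparison with position `0F` is absorbed into these bounds, while being a
  -- right-to-left minimum ignores everything to the left.
  Extremal-tail : ∀ {ℓ h} j → Extremal ℓ h τ (Fin.suc j) ⇔ Extremal (ℓ ⊓ v) (h ⊓ (t ∸ v)) σ j
  Extremal-tail {ℓ} {h} j = mk⇔ forth back
    where
    t≤x+[t∸v] : ∀ {x} → v ≤ x → t ≤ x + (t ∸ v)
    t≤x+[t∸v] {x} v≤x = subst (_≤ x + (t ∸ v)) (m+[n∸m]≡n v≤t) (+-monoˡ-≤ (t ∸ v) v≤x)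

    forth : Extremal ℓ h τ (Fin.suc j) → Extremal (ℓ ⊓ v) (h ⊓ (t ∸ v)) σ j
    forth (inj₁ (b , m)) with suc-split j | m 0F z<s
    ... | inj₁ (p , q) | _ =
      inj₁ (⊓-glb (subst (_< ℓ) q b) p , λ i i<j → remove-cancel (m (Fin.suc i) (s<s i<j)))
    ... | inj₂ (p , q) | r = contradiction (subst (_< v) q r) (≤⇒≯ (m≤n⇒m≤1+n p))
    forth (inj₂ (inj₁ (b , m))) with suc-split j | m 0F z<s
    ... | inj₁ (p , q) | r = contradiction (subst (v <_) q r) (<⇒≯ p)
    ... | inj₂ (p , q) | _ =
      inj₂ (inj₁ ( subst (t ≤_) (sym (+-distribˡ-⊓ (σ [ j ]) h (t ∸ v)))
                     (⊓-glb (s≤s⁻¹ (subst (λ x → suc t ≤ x + h) q b)) (t≤x+[t∸v] p))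
                 , λ i i<j → remove-cancel (m (Fin.suc i) (s<s i<j))))
    forth (inj₂ (inj₂ m)) = inj₂ (inj₂ λ k j<k → remove-cancel (m (Fin.suc k) (s<s j<k)))

    back : Extremal (ℓ ⊓ v) (h ⊓ (t ∸ v)) σ j → Extremal ℓ h τ (Fin.suc j)
    back (inj₁ (b , m)) with suc-split j
    ... | inj₁ (p , q) = inj₁ (subst (_< ℓ) (sym q) (m≤n⊓o⇒m≤n ℓ v b) , λ where
            Fin.zero    _         → subst (_< v) (sym q) p
            (Fin.suc i) (s<s i<j) → remove-mono (m i i<j))
    ... | inj₂ (p , q) = contradiction (m≤n⊓o⇒m≤o ℓ v b) (≤⇒≯ p)
    back (inj₂ (inj₁ (b , m))) with suc-split j
    ... | inj₁ (p , q) = contradiction p (≤⇒≯ v≤σj)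
      where
      v≤σj : v ≤ σ [ j ]
      v≤σj = +-cancelʳ-≤ (t ∸ v) v (σ [ j ])
        (subst (_≤ σ [ j ] + (t ∸ v)) (sym (m+[n∸m]≡n v≤t))
          (m≤n⊓o⇒m≤o _ _ (subst (t ≤_) (+-distribˡ-⊓ (σ [ j ]) h (t ∸ v)) b)))
    ... | inj₂ (p , q) = inj₂ (inj₁
            ( subst (λ x → suc t ≤ x + h) (sym q)
                (s≤s (m≤n⊓o⇒m≤n _ _ (subst (t ≤_) (+-distribˡ-⊓ (σ [ j ]) h (t ∸ v)) b)))
            , λ where
                Fin.zero    _         → subst (v <_) (sym q) (s≤s p)
                (Fin.suc i) (s<s i<j) → remove-mono (m i i<j)))
    back (inj₂ (inj₂ m)) = inj₂ (inj₂ λ where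
      (Fin.suc k) (s<s j<k) → remove-mono (m k j<k))

  -- The value 0 occurs somewhere; unless it is the head, it stands to the right of the head and
  -- below it.
  RLMin-head : RLMin τ 0F ⇔ v ≡ 0
  RLMin-head = mk⇔ forth back
    where
    value-0 : ∀ {k} → τ ⟨$⟩ˡ 0F ≡ k → τ [ k ] ≡ 0
    value-0 eq = cong toℕ (trans (cong (τ ⟨$⟩ʳ_) (sym eq)) (inverseʳ τ))

    forth : RLMin τ 0F → v ≡ 0
    forth m with τ ⟨$⟩ˡ 0F in eq
    ... | Fin.zero  = value-0 eq
    ... | Fin.suc k = contradiction (subst (v <_) (value-0 eq) (m (Fin.suc k) z<s)) λ ()

    back : v ≡ 0 → RLMin τ 0F
    back v≡0 (Fin.suc k) _ = ≤∧≢⇒< (subst (_≤ τ [ Fin.suc k ]) (sym v≡0) z≤n) λ eq →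
      contradiction ([]-injective τ eq) λ ()

-- Recursion on the first value

ExtremalHead : (t ℓ h v : ℕ) → Set
ExtremalHead t ℓ h v = v < ℓ ⊎ suc t ≤ v + h ⊎ v ≡ 0

Heads : (ℕ → Set) → (ℕ → Permutation′ t → Set) → Permutation′ (suc t) → Set
Heads X P τ = X (τ [ 0F ]) × P (τ [ 0F ]) (remove 0F τ)

ExtremalTail : (ℓ h : ℕ) → ℕ → Permutation′ t → Set
ExtremalTail {t} ℓ h v = AllExtremal (ℓ ⊓ v) (h ⊓ (t ∸ v))

-- Nothing precedes the head, so `LRMin` and `LRMax` are vacuous there and only the bounds on its
-- value remain.
AllExtremal-suc : ∀ {ℓ h} (τ : Permutation′ (suc t)) →
  AllExtremal ℓ h τ ⇔ Heads (ExtremalHead t ℓ h) (ExtremalTail ℓ h) τ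
AllExtremal-suc {t} {ℓ} {h} τ = mk⇔
  (λ ext → forth (ext 0F) , λ j → Equivalence.to (Extremal-tail τ j) (ext (Fin.suc j)))
  (λ { (hd , ext) Fin.zero    → back hd
     ; (hd , ext) (Fin.suc j) → Equivalence.from (Extremal-tail τ j) (ext j) })
  where
  forth : Extremal ℓ h τ 0F → ExtremalHead t ℓ h (τ [ 0F ])
  forth (inj₁ (b , _))        = inj₁ b
  forth (inj₂ (inj₁ (b , _))) = inj₂ (inj₁ b)
  forth (inj₂ (inj₂ m))       = inj₂ (inj₂ (Equivalence.to (RLMin-head τ) m))
  back : ExtremalHead t ℓ h (τ [ 0F ]) → Extremal ℓ h τ 0F
  back (inj₁ b)        = inj₁ (b , λ _ ())
  back (inj₂ (inj₁ b)) = inj₂ (inj₁ (b , λ _ ()))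
  back (inj₂ (inj₂ e)) = inj₂ (inj₂ (Equivalence.from (RLMin-head τ) e))

-- Enumerations up to pointwise equality

record Enumeration (P : Permutation′ n → Set) (N : ℕ) : Set where
  field
    at        : Fin N → Permutation′ n
    sound     : ∀ k → P (at k)
    injective : ∀ {i j} → at i ≈ at j → i ≡ j
    complete  : ∀ {τ} → P τ → ∃[ k ] at k ≈ τ

open Enumeration

enum-⇔ : {P Q : Permutation′ n → Set} → (∀ τ → P τ ⇔ Q τ) → Enumeration P N → Enumeration Q N
enum-⇔ P⇔Q E = record
  { at        = at E
  ; sound     = λ k → Equivalence.to (P⇔Q _) (sound E k)
  ; injective = injective E
  ; complete  = λ q → complete E (Equivalence.from (P⇔Q _) q)
  }

-- Disjointness has to hold across `≈`, because the injectivity of an enumeration is itself stated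
-- up to `≈`.
enum-⊎ : {P Q : Permutation′ n → Set} → (∀ {σ τ} → σ ≈ τ → P σ → ¬ Q τ) →
  Enumeration P M → Enumeration Q N → Enumeration (λ τ → P τ ⊎ Q τ) (M + N)
enum-⊎ {n} {M} {N} {P} {Q} disjoint E F = record
  { at        = at′ ∘ splitAt M
  ; sound     = λ k → sound′ (splitAt M k)
  ; injective = λ {i} {j} eq →
      trans (sym (Fin.join-splitAt M N i))
        (trans (cong (join M N) (injective′ (splitAt M i) (splitAt M j) eq)) (Fin.join-splitAt M N j))
  ; complete  = λ {τ} → λ where
      (inj₁ p) → let k , eq = complete E p in join M N (inj₁ k) , at-join (inj₁ k) τ eq
      (inj₂ q) → let k , eq = complete F q in join M N (inj₂ k) , at-join (inj₂ k) τ eq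
  }
  where
  at′ : Fin M ⊎ Fin N → Permutation′ n
  at′ = [ at E , at F ]′

  at-join : ∀ x τ → at′ x ≈ τ → at′ (splitAt M (join M N x)) ≈ τ
  at-join x τ = subst (λ y → at′ y ≈ τ) (sym (Fin.splitAt-join M N x))

  sound′ : ∀ x → P (at′ x) ⊎ Q (at′ x)
  sound′ (inj₁ k) = inj₁ (sound E k)
  sound′ (inj₂ k) = inj₂ (sound F k)

  injective′ : ∀ x y → at′ x ≈ at′ y → x ≡ y
  injective′ (inj₁ i) (inj₁ j) eq = cong inj₁ (injective E eq)
  injective′ (inj₁ i) (inj₂ j) eq = contradiction (sound F j) (disjoint eq (sound E i))
  injective′ (inj₂ i) (inj₁ j) eq = contradiction (sound F i) (disjoint (sym ∘ eq) (sound E j))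
  injective′ (inj₂ i) (inj₂ j) eq = cong inj₂ (injective F eq)

-- Enumerating by the first value

∑ : (ℕ → ℕ) → (a n : ℕ) → ℕ
∑ f a zero    = 0
∑ f a (suc n) = f a + ∑ f (suc a) n

module _ {P : ℕ → Permutation′ t → Set} where

  heads-⇔ : ∀ {X Y} → (∀ v → v ≤ t → X v ⇔ Y v) → Enumeration (Heads X P) N → Enumeration (Heads Y P) N
  heads-⇔ X⇔Y = enum-⇔ λ τ →
    let open Equivalence (X⇔Y (τ [ 0F ]) (Fin.toℕ≤pred[n] (τ ⟨$⟩ʳ 0F))) in
    mk⇔ (λ (x , p) → to x , p) (λ (y , p) → from y , p)

  heads-⊎ : ∀ {X Y} → (∀ {v} → X v → ¬ Y v) → Enumeration (Heads X P) M → Enumeration (Heads Y P) N →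
    Enumeration (Heads (λ v → X v ⊎ Y v) P) (M + N)
  heads-⊎ {Y = Y} disjoint E F = enum-⇔
    (λ τ → mk⇔ (λ { (inj₁ (x , p)) → inj₁ x , p ; (inj₂ (y , p)) → inj₂ y , p })
               (λ { (inj₁ x , p) → inj₁ (x , p) ; (inj₂ y , p) → inj₂ (y , p) }))
    (enum-⊎ (λ eq (x , _) (y , _) → disjoint x (subst Y (cong toℕ (sym (eq 0F))) y)) E F)

  heads-∅ : ∀ {X} → (∀ v → ¬ X v) → Enumeration (Heads X P) 0
  heads-∅ none = record
    { at = λ () ; sound = λ () ; injective = λ {} ; complete = λ (x , _) → contradiction x (none _) }

  -- Putting `v` in front of each enumerated tail reaches every permutation with first value `v`,
  -- since such a permutation is determined by its tail.
  heads-≡ : (∀ {v} σ τ → σ ≈ τ → P v σ → P v τ) → ∀ {v} → v ≤ t →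
    Enumeration (P v) N → Enumeration (Heads (_≡ v) P) N
  heads-≡ resp {v} v≤t E = record
    { at        = λ k → insert 0F u (at E k)
    ; sound     = λ k → toℕu≡v ,
        -- Removing the inserted head gives back the tail only up to `≈`, so `P` must be transported
        -- along `≈`.
        resp (at E k) (remove 0F (insert 0F u (at E k))) (sym ∘ Perm.remove-insert 0F u (at E k))
          (subst (λ x → P x (at E k)) (sym toℕu≡v) (sound E k))
    ; injective = λ {i} {j} eq → injective E λ x → Fin.punchIn-injective u _ _
        (trans (sym (Perm.insert-punchIn 0F u (at E i) x))
          (trans (eq (Fin.suc x)) (Perm.insert-punchIn 0F u (at E j) x)))
    ; complete  = λ {τ} (e , p) →
        let k , eq = complete E (subst (λ x → P x (remove 0F τ)) e p)
            u≡τ0   = Fin.toℕ-injective (trans toℕu≡v (sym e))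
        in k , λ where
          Fin.zero    → u≡τ0
          (Fin.suc x) → trans (Perm.insert-punchIn 0F u (at E k) x)
            (trans (cong₂ punchIn u≡τ0 (eq x)) (sym (Perm.punchIn-permute τ 0F x)))
    }
    where
    u : Fin (suc t)
    u = fromℕ< (s≤s v≤t)
    toℕu≡v : toℕ u ≡ v
    toℕu≡v = Fin.toℕ-fromℕ< (s≤s v≤t)

  heads-interval : (∀ {v} σ τ → σ ≈ τ → P v σ → P v τ) →
    ∀ f a n → a + n ≤ suc t → (∀ v → a ≤ v → v < a + n → Enumeration (P v) (f v)) →
    Enumeration (Heads (λ v → a ≤ v × v < a + n) P) (∑ f a n)
  heads-interval resp f a zero    bound E =
    heads-∅ {X = λ v → a ≤ v × v < a + 0} λ v (p , q) → ≤⇒≯ p (subst (v <_) (+-identityʳ a) q)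
  heads-interval resp f a (suc n) bound E = heads-⇔ {X = λ v → v ≡ a ⊎ Rest v}
    (λ v _ → mk⇔ to from)
    (heads-⊎ {X = _≡ a} {Y = Rest} (λ { refl (p , _) → <-irrefl refl p })
      (heads-≡ resp (s≤s⁻¹ (≤-trans (m<m+n a z<s) bound)) (E a ≤-refl (m<m+n a z<s)))
      (heads-interval resp f (suc a) n (subst (_≤ suc t) (+-suc a n) bound)
        λ v p q → E v (<⇒≤ p) (subst (v <_) (sym (+-suc a n)) q)))
    where
    Rest : ℕ → Set
    Rest v = a < v × v < suc a + n

    to : ∀ {v} → v ≡ a ⊎ Rest v → a ≤ v × v < a + suc n
    to     (inj₁ refl)    = ≤-refl , m<m+n a z<s
    to {v} (inj₂ (p , q)) = <⇒≤ p , subst (v <_) (sym (+-suc a n)) q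

    from : ∀ {v} → a ≤ v × v < a + suc n → v ≡ a ⊎ Rest v
    from {v} (p , q) with v ≟ a
    ... | yes v≡a = inj₁ v≡a
    ... | no  v≢a = inj₂ (≤∧≢⇒< p (v≢a ∘ sym) , subst (v <_) (+-suc a n) q)

-- Ballot numbers and binomial coefficients

-- With e = t - h this is C(t+h, h) - C(t+h, h-1).
ballot : (e h : ℕ) → ℕ
ballot e       zero    = 1
ballot zero    (suc h) = ballot 1 h
ballot (suc e) (suc h) = ballot (2 + e) h + ballot e (suc h)

nC0≡1 : ∀ n → n C 0 ≡ 1
nC0≡1 n = trans (nCk≡nC[n∸k] {n = n} z≤n) (nCn≡1 n)

-- C(e+2h, h-1)
predC : (e h : ℕ) → ℕ
predC e zero    = 0
predC e (suc h) = (2 + (e + (h + h))) C h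

e+2[1+h] : ∀ e h → e + (suc h + suc h) ≡ 2 + (e + (h + h))
e+2[1+h] = solve-∀

C+predC : ∀ e h → (e + (h + h)) C h + predC e h ≡ suc (e + (h + h)) C h
C+predC e zero    = trans (+-identityʳ ((e + 0) C 0)) (trans (nC0≡1 (e + 0)) (sym (nC0≡1 (suc (e + 0)))))
C+predC e (suc h) rewrite e+2[1+h] e h =
  trans (+-comm ((2 + (e + (h + h))) C suc h) _) (nCk+nC[k+1]≡[n+1]C[k+1] (2 + (e + (h + h))) h)

-- Pascal's rule: `predC` obeys the same recurrence as `ballot`.
predC-suc : ∀ e h → predC (suc e) (suc h) ≡ predC (2 + e) h + predC e (suc h)
predC-suc e h = sym (trans (+-comm (predC (2 + e) h) _) (C+predC (2 + e) h))

-- The closed form of `ballot`, written without subtraction. The induction follows the recursion of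
-- `ballot`, with Pascal's rule on the binomial side.
ballot+predC : ∀ e h → ballot e h + predC e h ≡ (e + (h + h)) C h
ballot+predC e       zero    = sym (nC0≡1 (e + 0))
ballot+predC zero    (suc h) = begin
  ballot 1 h + (2 + (h + h)) C h
    ≡⟨ cong (ballot 1 h +_) (C+predC 1 h) ⟨
  ballot 1 h + ((1 + (h + h)) C h + predC 1 h)
    ≡⟨ x+[y+z] (ballot 1 h) ((1 + (h + h)) C h) _ ⟩
  (1 + (h + h)) C h + (ballot 1 h + predC 1 h)
    ≡⟨ cong ((1 + (h + h)) C h +_) (trans (ballot+predC 1 h) symm) ⟩
  (1 + (h + h)) C h + (1 + (h + h)) C suc h
    ≡⟨ nCk+nC[k+1]≡[n+1]C[k+1] (1 + (h + h)) h ⟩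
  (2 + (h + h)) C suc h
    ≡⟨ cong (_C suc h) (e+2[1+h] 0 h) ⟨
  (suc h + suc h) C suc h ∎
  where
  open ≡-Reasoning
  x+[y+z] : ∀ x y z → x + (y + z) ≡ y + (x + z)
  x+[y+z] = solve-∀
  -- `ballot zero (suc h)` has one summand where the general recurrence has two; the absent term
  -- C(2h+1, h+1) - C(2h+1, h) vanishes by this symmetry.
  symm : (1 + (h + h)) C h ≡ (1 + (h + h)) C suc h
  symm = trans (nCk≡nC[n∸k] (m≤n⇒m≤1+n (m≤m+n h h)))
    (cong ((1 + (h + h)) C_) (m+n∸n≡m (suc h) h))
ballot+predC (suc e) (suc h) = begin
  ballot (2 + e) h + ballot e (suc h) + predC (suc e) (suc h)
    ≡⟨ cong (ballot (2 + e) h + ballot e (suc h) +_) (predC-suc e h) ⟩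
  ballot (2 + e) h + ballot e (suc h) + (predC (2 + e) h + predC e (suc h))
    ≡⟨ interchange (ballot (2 + e) h) _ _ _ ⟩
  (ballot (2 + e) h + predC (2 + e) h) + (ballot e (suc h) + predC e (suc h))
    ≡⟨ cong₂ _+_ (ballot+predC (2 + e) h) (ballot+predC e (suc h)) ⟩
  (2 + (e + (h + h))) C h + (e + (suc h + suc h)) C suc h
    ≡⟨ cong (λ n → (2 + (e + (h + h))) C h + n C suc h) (e+2[1+h] e h) ⟩
  (2 + (e + (h + h))) C h + (2 + (e + (h + h))) C suc h
    ≡⟨ nCk+nC[k+1]≡[n+1]C[k+1] (2 + (e + (h + h))) h ⟩
  suc (2 + (e + (h + h))) C suc h
    ≡⟨ cong (λ n → suc n C suc h) (e+2[1+h] e h) ⟨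
  suc (e + (suc h + suc h)) C suc h ∎
  where
  open ≡-Reasoning
  interchange : ∀ w x y z → w + x + (y + z) ≡ (w + y) + (x + z)
  interchange = solve-∀

-- Pascal's rule followed by the closed form of `ballot`. The factor 2 matches the doubling of
-- `weight` from one first value to the next.
predC≡ballot+2*predC : ∀ e h → predC e (suc h) ≡ ballot (suc e) h + 2 * predC (suc e) h
predC≡ballot+2*predC e h = begin
  predC e (suc h)                                       ≡⟨ C+predC (suc e) h ⟨
  suc (e + (h + h)) C h + predC (suc e) h               ≡⟨ cong (_+ predC (suc e) h) (ballot+predC (suc e) h) ⟨
  ballot (suc e) h + predC (suc e) h + predC (suc e) h  ≡⟨ x+y+y (ballot (suc e) h) _ ⟩
  ballot (suc e) h + 2 * predC (suc e) h                ∎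
  where
  open ≡-Reasoning
  x+y+y : ∀ x y → x + y + y ≡ x + 2 * y
  x+y+y = solve-∀

-- Summing the counts over the first value

weight : ℕ → ℕ
weight zero    = 1
weight (suc m) = 2 ^ m

-- A geometric sum of powers of 2, with the lower end `2 ^ a` moved to the left to avoid
-- subtraction.
∑-weight : ∀ x a n → ∑ (λ v → weight v * x) (suc a) n + 2 ^ a * x ≡ 2 ^ (a + n) * x
∑-weight x a zero    = cong (λ b → 2 ^ b * x) (sym (+-identityʳ a))
∑-weight x a (suc n) = begin
  2 ^ a * x + ∑ f (2 + a) n + 2 ^ a * x  ≡⟨ regroup (2 ^ a) x _ ⟩
  ∑ f (2 + a) n + 2 ^ suc a * x          ≡⟨ ∑-weight x (suc a) n ⟩
  2 ^ (suc a + n) * x                    ≡⟨ cong (λ b → 2 ^ b * x) (+-suc a n) ⟨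
  2 ^ (a + suc n) * x                    ∎
  where
  open ≡-Reasoning
  f : ℕ → ℕ
  f v = weight v * x
  regroup : ∀ p x s → p * x + s + p * x ≡ s + 2 * p * x
  regroup = solve-∀

-- The `⊔ 1` matters for `ℓ = 0`: no value is low, yet the least remaining value 0 is still allowed
-- as a head. For positive `ℓ` it is already one of the low values.
∑-weight-from-0 : ∀ ℓ x → ∑ (λ v → weight v * x) 0 (ℓ ⊔ 1) ≡ weight ℓ * x
∑-weight-from-0 zero    x = +-identityʳ _
∑-weight-from-0 (suc m) x = begin
  ∑ f 0 (suc (m ⊔ 0))        ≡⟨ cong (λ k → ∑ f 0 (suc k)) (⊔-identityʳ m) ⟩
  1 * x + ∑ f 1 m            ≡⟨ +-comm (1 * x) _ ⟩
  ∑ f 1 m + 1 * x            ≡⟨ ∑-weight x 0 m ⟩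
  2 ^ m * x                  ∎
  where
  open ≡-Reasoning
  f : ℕ → ℕ
  f v = weight v * x

[1+e+h]∸[1+e] : ∀ {e h t} → e + suc h ≡ t → t ∸ suc e ≡ h
[1+e+h]∸[1+e] {e} {h} refl = trans (cong (_∸ suc e) (+-suc e h)) (m+n∸m≡n e h)

-- The recurrence of `ballot` unrolled along its first summand. In the count, the sum comes from the
-- high heads and `w * ballot e h` from the low ones.
∑-ballot : ∀ w e h → e + h ≡ t →
  ∑ (λ v → w * ballot v (t ∸ v)) (suc e) h + w * ballot e h ≡ w * ballot (suc e) h
∑-ballot w e zero refl = refl
∑-ballot {t} w e (suc h) eq = begin
  w * ballot (suc e) (t ∸ suc e) + s + w * ballot e (suc h)
    ≡⟨ cong (λ k → w * ballot (suc e) k + s + w * ballot e (suc h)) ([1+e+h]∸[1+e] eq) ⟩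
  w * ballot (suc e) h + s + w * ballot e (suc h)
    ≡⟨ cong (_+ w * ballot e (suc h)) (+-comm (w * ballot (suc e) h) s) ⟩
  s + w * ballot (suc e) h + w * ballot e (suc h)
    ≡⟨ cong (_+ w * ballot e (suc h)) (∑-ballot w (suc e) h (trans (sym (+-suc e h)) eq)) ⟩
  w * ballot (2 + e) h + w * ballot e (suc h)
    ≡⟨ *-distribˡ-+ w (ballot (2 + e) h) _ ⟨
  w * ballot (suc e) (suc h) ∎
  where
  open ≡-Reasoning
  s = ∑ (λ v → w * ballot v (t ∸ v)) (2 + e) h

-- Starting at `suc e` avoids the exceptional `weight 0`, so the leading weight is `2 ^ e` and each
-- step is `predC≡ballot+2*predC`.
∑-weight*ballot : ∀ e h → e + h ≡ t →
  ∑ (λ v → weight v * ballot v (t ∸ v)) (suc e) h ≡ 2 ^ e * predC e h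
∑-weight*ballot e zero _ = sym (*-zeroʳ (2 ^ e))
∑-weight*ballot {t} e (suc h) eq = begin
  2 ^ e * ballot (suc e) (t ∸ suc e) + s
    ≡⟨ cong₂ (λ k x → 2 ^ e * ballot (suc e) k + x) ([1+e+h]∸[1+e] eq)
         (∑-weight*ballot (suc e) h (trans (sym (+-suc e h)) eq)) ⟩
  2 ^ e * ballot (suc e) h + 2 ^ suc e * predC (suc e) h
    ≡⟨ factor (2 ^ e) _ _ ⟩
  2 ^ e * (ballot (suc e) h + 2 * predC (suc e) h)
    ≡⟨ cong (2 ^ e *_) (predC≡ballot+2*predC e h) ⟨
  2 ^ e * predC e (suc h) ∎
  where
  open ≡-Reasoning
  s = ∑ (λ v → weight v * ballot v (t ∸ v)) (2 + e) h
  factor : ∀ p x y → p * x + 2 * p * y ≡ p * (x + 2 * y)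
  factor = solve-∀

-- The term at 0 is C(2t, t) - C(2t, t-1), and the remaining terms add up to C(2t, t-1).
∑-weight*ballot-from-0 : ∀ t → ∑ (λ v → weight v * ballot v (t ∸ v)) 0 (suc t) ≡ (2 * t) C t
∑-weight*ballot-from-0 t = begin
  1 * ballot 0 t + ∑ (λ v → weight v * ballot v (t ∸ v)) 1 t
    ≡⟨ cong₂ _+_ (*-identityˡ _) (trans (∑-weight*ballot 0 t refl) (*-identityˡ _)) ⟩
  ballot 0 t + predC 0 t  ≡⟨ ballot+predC 0 t ⟩
  (t + t) C t             ≡⟨ cong (λ k → (t + k) C t) (+-identityʳ t) ⟨
  (2 * t) C t             ∎
  where open ≡-Reasoning

-- Enumerating the extremal permutations

enum-tail : ∀ {ℓ h v ℓ′ h′} → ℓ ⊓ v ≡ ℓ′ → h ⊓ (t ∸ v) ≡ h′ →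
  Enumeration {t} (AllExtremal ℓ′ h′) N → Enumeration (ExtremalTail ℓ h v) N
enum-tail refl refl E = E

enum-suc : ∀ {ℓ h} → Enumeration {suc t} (Heads (ExtremalHead t ℓ h) (ExtremalTail ℓ h)) N →
  Enumeration (AllExtremal ℓ h) N
enum-suc = enum-⇔ λ τ → let open Equivalence (AllExtremal-suc τ) in mk⇔ from to

-- After a head `v ≤ e` exactly `v` values are low, and all `h` high values stay high because they
-- lie above `v`.
enum-low-heads : ∀ {ℓ e h} → ℓ ≤ suc e → e + h ≡ t →
  (∀ v → v ≤ e → Enumeration {t} (AllExtremal v h) (weight v * ballot e h)) →
  Enumeration {suc t} (Heads (λ v → 0 ≤ v × v < ℓ ⊔ 1) (ExtremalTail ℓ h)) (weight ℓ * ballot e h)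
enum-low-heads {t} {ℓ} {e} {h} ℓ≤1+e eq E = subst (Enumeration _) (∑-weight-from-0 ℓ (ballot e h))
  (heads-interval {P = ExtremalTail ℓ h} AllExtremal-resp-≈ _ 0 (ℓ ⊔ 1) bound λ v _ v<ℓ⊔1 →
    let v≤e = s≤s⁻¹ (≤-trans v<ℓ⊔1 (⊔-lub ℓ≤1+e (s≤s z≤n))) in
    enum-tail (ℓ⊓v≡v ℓ v<ℓ⊔1)
      (m≤n⇒m⊓n≡m (m+n≤o⇒m≤o∸n h (≤-trans (+-monoʳ-≤ h v≤e) (≤-reflexive (trans (+-comm h e) eq)))))
      (E v v≤e))
  where
  bound : ℓ ⊔ 1 ≤ suc t
  bound = ≤-trans (⊔-lub ℓ≤1+e (s≤s z≤n)) (s≤s (subst (e ≤_) eq (m≤m+n e h)))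

  ℓ⊓v≡v : ∀ ℓ {v} → v < ℓ ⊔ 1 → ℓ ⊓ v ≡ v
  ℓ⊓v≡v zero    (s≤s z≤n) = refl
  ℓ⊓v≡v (suc m) {v} v<    = m≥n⇒m⊓n≡n (<⇒≤ (subst (v <_) (cong suc (⊔-identityʳ m)) v<))

-- After a head `v ≥ e` the `ℓ` low values, all below `v`, stay low, and exactly the `t ∸ v` values
-- above `v` stay high.
enum-high-heads : ∀ {ℓ e h} → ℓ ≤ e → e + h ≡ suc t →
  (∀ v → ℓ ≤ v → v ≤ t → Enumeration {t} (AllExtremal ℓ (t ∸ v)) (weight ℓ * ballot v (t ∸ v))) →
  Enumeration {suc t} (Heads (λ v → e ≤ v × v < e + h) (ExtremalTail ℓ h))
    (∑ (λ v → weight ℓ * ballot v (t ∸ v)) e h)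
enum-high-heads {t} {ℓ} {e} {h} ℓ≤e eq E =
  heads-interval {P = ExtremalTail ℓ h} AllExtremal-resp-≈ _ e h (≤-reflexive eq) λ v e≤v v<e+h →
    enum-tail (m≤n⇒m⊓n≡m (≤-trans ℓ≤e e≤v))
      (m≥n⇒m⊓n≡n (m≤n+o⇒m∸n≤o t v
        (≤-trans (n≤1+n t) (≤-trans (≤-reflexive (sym eq)) (+-monoˡ-≤ h e≤v)))))
      (E v (≤-trans ℓ≤e e≤v) (s≤s⁻¹ (subst (v <_) eq v<e+h)))

-- The hypothesis `ℓ ≤ e` says that low and high values do not overlap, which holds after any
-- nonempty prefix. Low and high heads are then counted separately and recombined by `∑-ballot`.
enum-extremal : ∀ t {ℓ e h} → ℓ ≤ e → e + h ≡ t → Enumeration {t} (AllExtremal ℓ h) (weight ℓ * ballot e h)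
enum-extremal zero {e = zero} {zero} z≤n refl = record
  { at        = λ _ → Perm.id
  ; sound     = λ _ ()
  ; injective = λ { {0F} {0F} _ → refl }
  ; complete  = λ _ → 0F , λ ()
  }
-- Here every remaining value is high, so the least one is not an additional head and there is no
-- separate low range.
enum-extremal (suc t) {e = zero} z≤n refl =
  subst (Enumeration _) (trans (+-comm (1 * ballot 0 t) _) (∑-ballot 1 0 t refl))
    (enum-suc
      (heads-⇔ {P = ExtremalTail 0 (suc t)} {Y = ExtremalHead t 0 (suc t)}
        (λ v v≤t → mk⇔ (λ _ → inj₂ (inj₁ (m≤n+m (suc t) v))) (λ _ → z≤n {v} , s≤s v≤t))
        (enum-high-heads z≤n refl λ v _ v≤t → enum-extremal t z≤n (m+[n∸m]≡n v≤t))))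
enum-extremal (suc t) {ℓ} {suc e} {h} ℓ≤1+e eq =
  subst (Enumeration _)
    (trans (+-comm (weight ℓ * ballot e h) _) (∑-ballot (weight ℓ) e h (suc-injective eq)))
    (enum-suc
      (heads-⇔ {P = ExtremalTail ℓ h} {X = λ v → Low v ⊎ High v} (λ v v≤t → mk⇔ from (to v≤t))
        (heads-⊎ {P = ExtremalTail ℓ h} {X = Low} {Y = High}
          (λ (_ , p) (q , _) → <⇒≱ (≤-trans p (⊔-lub ℓ≤1+e (s≤s z≤n))) q)
          (enum-low-heads ℓ≤1+e (suc-injective eq) λ v v≤e → enum-extremal t v≤e (suc-injective eq))
          (enum-high-heads ℓ≤1+e eq λ v ℓ≤v v≤t → enum-extremal t ℓ≤v (m+[n∸m]≡n v≤t)))))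
  where
  Low High : ℕ → Set
  Low  v = 0 ≤ v × v < ℓ ⊔ 1
  High v = suc e ≤ v × v < suc e + h

  from : ∀ {v} → Low v ⊎ High v → ExtremalHead t ℓ h v
  from {v} (inj₁ (_ , v<ℓ⊔1)) with ⊔-sel ℓ 1
  ... | inj₁ q = inj₁ (subst (v <_) q v<ℓ⊔1)
  ... | inj₂ q = inj₂ (inj₂ (n<1⇒n≡0 (subst (v <_) q v<ℓ⊔1)))
  from {v} (inj₂ (p , _)) = inj₂ (inj₁ (subst (_≤ v + h) eq (+-monoˡ-≤ h p)))

  to : ∀ {v} → v ≤ t → ExtremalHead t ℓ h v → Low v ⊎ High v
  to v≤t (inj₁ v<ℓ)        = inj₁ (z≤n , ≤-trans v<ℓ (m≤m⊔n ℓ 1))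
  to {v} v≤t (inj₂ (inj₁ p)) =
    inj₂ (+-cancelʳ-≤ h (suc e) v (subst (_≤ v + h) (sym eq) p) , subst (v <_) (sym eq) (s≤s v≤t))
  to v≤t (inj₂ (inj₂ refl)) = inj₁ (z≤n , m≤n⊔m ℓ 1)

-- Before anything is read, every value counts as both low and high, so `enum-extremal` applies only
-- to the tails: a head `v` leaves `v` low and `t ∸ v` high values.
enum-all-extremal : ∀ t → Enumeration {suc t} (AllExtremal (suc t) (suc t)) ((2 * t) C t)
enum-all-extremal t = subst (Enumeration _) (∑-weight*ballot-from-0 t)
  (enum-suc
    (heads-⇔ {P = ExtremalTail (suc t) (suc t)} {Y = ExtremalHead t (suc t) (suc t)}
      (λ v v≤t → mk⇔ (λ _ → inj₁ (s≤s v≤t)) (λ _ → z≤n {v} , s≤s v≤t))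
      (heads-interval {P = ExtremalTail (suc t) (suc t)} AllExtremal-resp-≈ _ 0 (suc t) ≤-refl λ v _ v<1+t →
        enum-tail (m≥n⇒m⊓n≡n (<⇒≤ v<1+t)) (m≥n⇒m⊓n≡n (m≤n⇒m≤1+n (m∸n≤m t v)))
          (enum-extremal t ≤-refl (m+[n∸m]≡n (s≤s⁻¹ v<1+t))))))

-- Pattern avoidance and extremality

mono₄ : ∀ (f : Fin 4 → ℕ) → f 0F < f 1F → f 1F < f 2F → f 2F < f 3F → ∀ {a b} → a Fin.< b → f a < f b
mono₄ f p q r {0F} {1F} _ = p
mono₄ f p q r {0F} {2F} _ = <-trans p q
mono₄ f p q r {0F} {3F} _ = <-trans p (<-trans q r)
mono₄ f p q r {1F} {2F} _ = q
mono₄ f p q r {1F} {3F} _ = <-trans q r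
mono₄ f p q r {2F} {3F} _ = r
mono₄ f p q r {1F} {1F} (s<s ())
mono₄ f p q r {2F} {1F} (s<s ())
mono₄ f p q r {2F} {2F} (s<s (s<s ()))
mono₄ f p q r {3F} {1F} (s<s ())
mono₄ f p q r {3F} {2F} (s<s (s<s ()))
mono₄ f p q r {3F} {3F} (s<s (s<s (s<s ())))

-- Listing the chosen entries in the order of their pattern values, through the inverse of `π`,
-- reduces order-isomorphism to three inequalities; the converse implication follows because the
-- order is total.
contains₄ : ∀ (τ : Permutation′ n) (π : Permutation′ 4) (i : Fin 4 → Fin n) →
  i 0F Fin.< i 1F → i 1F Fin.< i 2F → i 2F Fin.< i 3F →
  let value = λ a → τ [ i (π ⟨$⟩ˡ a) ] in
  value 0F < value 1F → value 1F < value 2F → value 2F < value 3F → τ Contains π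
contains₄ τ π i p q r u v w = i , mono₄ (toℕ ∘ i) p q r , λ a b → mk⇔
  (λ τa<τb → ≰⇒> λ πb≤πa → <⇒≱ τa<τb (weak πb≤πa))
  (λ πa<πb → subst₂ _<_ (value∘π a) (value∘π b) (mono₄ value u v w πa<πb))
  where
  value : Fin 4 → ℕ
  value a = τ [ i (π ⟨$⟩ˡ a) ]

  value∘π : ∀ a → value (π ⟨$⟩ʳ a) ≡ τ [ i a ]
  value∘π a = cong (λ x → τ [ i x ]) (inverseˡ π)

  weak : ∀ {a b} → π [ a ] ≤ π [ b ] → τ [ i a ] ≤ τ [ i b ]
  weak {a} {b} πa≤πb with m≤n⇒m<n∨m≡n πa≤πb
  ... | inj₁ πa<πb = <⇒≤ (subst₂ _<_ (value∘π a) (value∘π b) (mono₄ value u v w πa<πb))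
  ... | inj₂ πa≡πb = ≤-reflexive (cong (λ x → τ [ i x ]) ([]-injective π πa≡πb))

Π : Patterns
Π = (4 , π2431) ∷ (4 , π4231) ∷ (4 , π1432) ∷ (4 , π4132) ∷ []

∀⊎∃¬ : ∀ {R S : Fin n → Set} → Decidable R → Decidable S → (∀ i → R i → S i) ⊎ (∃[ i ] R i × ¬ S i)
∀⊎∃¬ {n} R? S? with Fin.all? (λ i → R? i →-dec S? i)
... | yes all = inj₁ all
... | no ¬all with Fin.¬∀⟶∃¬ n _ (λ i → R? i →-dec S? i) ¬all
...   | i , ¬[R→S] with R? i
...     | yes r = inj₂ (i , r , λ s → ¬[R→S] λ _ → s)
...     | no ¬r = contradiction (λ r → contradiction r ¬r) ¬[R→S]

-- If `j` fails all three conditions, there are a smaller entry `a` and a larger entry `b` to its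
-- left and a smaller entry `c` to its right. Then `j` plays the 3 of a pattern; the order of the
-- positions `a`, `b` and of the values at `a`, `c` decides which of the four it is.
avoids⇒extremal : ∀ (τ : Permutation′ n) → τ AvoidsAll Π → AllExtremal n n τ
avoids⇒extremal {n} τ (¬2431 ∷ ¬4231 ∷ ¬1432 ∷ ¬4132 ∷ []) j
  with ∀⊎∃¬ (Fin._<? j) (λ i → τ [ j ] <? τ [ i ])
... | inj₁ min = inj₁ (Fin.toℕ<n _ , min)
... | inj₂ (a , a<j , τj≮τa) with ∀⊎∃¬ (Fin._<? j) (λ i → τ [ i ] <? τ [ j ])
...   | inj₁ max = inj₂ (inj₁ (m≤n+m n _ , max))
...   | inj₂ (b , b<j , τb≮τj) with ∀⊎∃¬ (j Fin.<?_) (λ k → τ [ j ] <? τ [ k ])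
...     | inj₁ min = inj₂ (inj₂ min)
...     | inj₂ (c , j<c , τj≮τc) = contradiction (<-cmp (toℕ a) (toℕ b)) absurd
  where
  ≮⇒> : ∀ {x y} → x ≢ y → ¬ τ [ x ] < τ [ y ] → τ [ y ] < τ [ x ]
  ≮⇒> x≢y x≮y = ≤∧≢⇒< (≮⇒≥ x≮y) (x≢y ∘ sym ∘ []-injective τ)

  a≺j : τ [ a ] < τ [ j ]
  a≺j = ≮⇒> (λ { refl → <-irrefl refl a<j }) τj≮τa
  j≺b : τ [ j ] < τ [ b ]
  j≺b = ≮⇒> (λ { refl → <-irrefl refl b<j }) τb≮τj
  c≺j : τ [ c ] < τ [ j ]
  c≺j = ≮⇒> (λ { refl → <-irrefl refl j<c }) τj≮τc

  absurd : ¬ Tri (a Fin.< b) (toℕ a ≡ toℕ b) (b Fin.< a)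
  absurd (tri≈ _ a≡b _) with refl ← Fin.toℕ-injective a≡b = <-asym a≺j j≺b
  absurd (tri< a<b _ _) with <-cmp (τ [ a ]) (τ [ c ])
  ... | tri< a≺c _ _ = ¬1432 (contains₄ τ π1432 (lookup (a ∷ b ∷ j ∷ c ∷ [])) a<b b<j j<c a≺c c≺j j≺b)
  ... | tri≈ _ a≡c _ with refl ← []-injective τ a≡c = <-asym a<j j<c
  ... | tri> _ _ c≺a = ¬2431 (contains₄ τ π2431 (lookup (a ∷ b ∷ j ∷ c ∷ [])) a<b b<j j<c c≺a a≺j j≺b)
  absurd (tri> _ _ b<a) with <-cmp (τ [ a ]) (τ [ c ])
  ... | tri< a≺c _ _ = ¬4132 (contains₄ τ π4132 (lookup (b ∷ a ∷ j ∷ c ∷ [])) b<a a<j j<c a≺c c≺j j≺b)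
  ... | tri≈ _ a≡c _ with refl ← []-injective τ a≡c = <-asym a<j j<c
  ... | tri> _ _ c≺a = ¬4231 (contains₄ τ π4231 (lookup (b ∷ a ∷ j ∷ c ∷ [])) b<a a<j j<c c≺a a≺j j≺b)

-- The third entry of the pattern has a smaller entry `a` and a larger entry `b` before it and a
-- smaller one after it, and each of these rules out one kind of extremality for its image in `τ`.
extremal⇒avoids₄ : ∀ {ℓ h} (τ : Permutation′ n) (π : Permutation′ 4) (a b : Fin 4) →
  toℕ a < 2 → toℕ b < 2 → π [ a ] < π [ 2F ] → π [ 2F ] < π [ b ] → π [ 3F ] < π [ 2F ] →
  AllExtremal ℓ h τ → τ Avoids π
extremal⇒avoids₄ τ π a b a<2 b<2 a≺2 2≺b 3≺2 ext (i , mono , ord) with ext (i 2F)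
... | inj₁ (_ , min)        = <-asym (min (i a) (mono a<2)) (Equivalence.from (ord a 2F) a≺2)
... | inj₂ (inj₁ (_ , max)) = <-asym (max (i b) (mono b<2)) (Equivalence.from (ord 2F b) 2≺b)
... | inj₂ (inj₂ min)       =
  <-asym (min (i 3F) (mono (s<s (s<s z<s)))) (Equivalence.from (ord 3F 2F) 3≺2)

extremal⇒avoids : ∀ {ℓ h} (τ : Permutation′ n) → AllExtremal ℓ h τ → τ AvoidsAll Π
extremal⇒avoids τ ext
  = extremal⇒avoids₄ τ π2431 0F 1F z<s (s<s z<s) (s<s z<s) (s<s (s<s z<s)) z<s ext
  ∷ extremal⇒avoids₄ τ π4231 1F 0F (s<s z<s) z<s (s<s z<s) (s<s (s<s z<s)) z<s ext
  ∷ extremal⇒avoids₄ τ π1432 0F 1F z<s (s<s z<s) z<s (s<s (s<s z<s)) (s<s z<s) ext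
  ∷ extremal⇒avoids₄ τ π4132 1F 0F (s<s z<s) z<s z<s (s<s (s<s z<s)) (s<s z<s) ext
  ∷ []

enumeration⇒S : ∀ {Φ} → Enumeration {n} (_AvoidsAll Φ) N → S[ n , Φ ]≡ N
enumeration⇒S E = Bijection⇒Inverse (record
  { to        = λ k → at E k , sound E k
  ; cong      = λ { refl _ → refl }
  ; bijective = injective E , λ (τ , avoids) →
      let k , eq = complete E {τ} avoids in k , λ { refl → eq }
  })

theorem1 : ∀ (n : ℕ) → 1 ≤ n →
    S[ n , (4 , π2431) ∷ (4 , π4231) ∷ (4 , π1432) ∷ (4 , π4132) ∷ [] ]≡ ((2 * (n ∸ 1)) C (n ∸ 1))
theorem1 (suc t) _ = enumeration⇒S
  (enum-⇔ (λ τ → mk⇔ (extremal⇒avoids τ) (avoids⇒extremal τ)) (enum-all-extremal t))
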